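{- Let $\langle P,\leq,{}^\bot,\&\rangle$ be a Sasaki orthoposet, and define the binary operation $\wedge_\& : P^2\to P$ by $$ a\wedge_\& b = (a^\bot \,\&\, b)^\bot \,\&\, b . $$ Then $\langle P,\leq,{}^\bot,\wedge_\&\rangle$ is an orthomodular lattice; that is, $\langle P,\le\rangle$ is a lattice whose meet operation is $\wedge_\&$, and with ${}^\bot$ it is an orthomodular lattice.
   Context: A bounded orthoposet $\langle P,\leq,{}^\bot\rangle$ is a partially ordered set with least element $0$ and greatest element $1$ and an orthocomplementation $a\mapsto a^\bot$, i.e. an order-reversing involution ($a\le b\Rightarrow b^\bot\le a^\bot$, $a^{\bot\bot}=a$) such that for every $a$ the meet of $a$ and $a^\bot$ exists and is $0$, and their join exists and is $1$. An ortholattice is a bounded orthoposet that is a lattice. An orthomodular lattice is an ortholattice in which $a\leq b$ implies $a=b\wedge(a\vee b^\bot)$. A Sasaki orthoposet is a tuple $\langle P,\leq,{}^\bot,\&\rangle$ where $\langle P,\leq,{}^\bot\rangle$ is a bounded orthoposet and $\&:P^2\to P$ is a total binary operation such that for all $a,b,c\in P$: (L-Monotony) $a\le b \Rightarrow a\,\&\,c\le b\,\&\,c$; (R-Reduction) $a\,\&\,b\le b$; (Orthomodularity) $a\le b\Rightarrow a=a\,\&\,b$; (Galois) $a\,\&\,b\le c\Rightarrow c^\bot\,\&\,b\le a^\bot$. -}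

module Defs where

open import Algebra.Core using (Op₁; Op₂)
open import Algebra.Definitions using (Involutive)
open import Data.Product.Base using (_×_)
open import Function.Base using (flip)
open import Level using (Level; suc; _⊔_)
open import Relation.Binary.Core using (Rel)
open import Relation.Binary.Definitions using (Maximum; Minimum)
open import Relation.Binary.Lattice.Structures using (IsLattice)
open import Relation.Binary.Structures using (IsPartialOrder)

private
  variable
    a ℓ : Level

-- Pointwise counterparts of the library's Supremum and Infimum: in a mere
-- poset only particular pairs of elements need have a join or a meet.

IsJoinOf : {A : Set a} → Rel A ℓ → A → A → A → Set (a ⊔ ℓ)
IsJoinOf _≤_ x y j = x ≤ j × y ≤ j × (∀ z → x ≤ z → y ≤ z → j ≤ z)

IsMeetOf : {A : Set a} → Rel A ℓ → A → A → A → Set (a ⊔ ℓ)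
IsMeetOf _≤_ = IsJoinOf (flip _≤_)

module _ {a ℓ₁ ℓ₂} {A : Set a} (_≈_ : Rel A ℓ₁) (_≤_ : Rel A ℓ₂) where

  record IsBoundedOrthoposet (_ᗮ : Op₁ A) (𝟏 𝟎 : A) : Set (a ⊔ ℓ₁ ⊔ ℓ₂) where
    field
      isPartialOrder : IsPartialOrder _≈_ _≤_
      maximum        : Maximum _≤_ 𝟏
      minimum        : Minimum _≤_ 𝟎
      ᗮ-antitone     : ∀ {x y} → x ≤ y → (y ᗮ) ≤ (x ᗮ)
      ᗮ-involutive   : Involutive _≈_ _ᗮ
      ᗮ-meet         : ∀ x → IsMeetOf _≤_ x (x ᗮ) 𝟎
      ᗮ-join         : ∀ x → IsJoinOf _≤_ x (x ᗮ) 𝟏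

    open IsPartialOrder isPartialOrder public

  record IsOrtholattice (_∨_ _∧_ : Op₂ A) (_ᗮ : Op₁ A) (𝟏 𝟎 : A)
                        : Set (a ⊔ ℓ₁ ⊔ ℓ₂) where
    field
      isBoundedOrthoposet : IsBoundedOrthoposet _ᗮ 𝟏 𝟎
      isLattice           : IsLattice _≈_ _≤_ _∨_ _∧_

    open IsBoundedOrthoposet isBoundedOrthoposet public
    open IsLattice isLattice public
      using (supremum; infimum; x≤x∨y; y≤x∨y; ∨-least; x∧y≤x; x∧y≤y; ∧-greatest)

  record IsOrthomodularLattice (_∨_ _∧_ : Op₂ A) (_ᗮ : Op₁ A) (𝟏 𝟎 : A)
                               : Set (a ⊔ ℓ₁ ⊔ ℓ₂) where
    field
      isOrtholattice : IsOrtholattice _∨_ _∧_ _ᗮ 𝟏 𝟎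
      orthomodular   : ∀ {x y} → x ≤ y → x ≈ (y ∧ (x ∨ (y ᗮ)))

    open IsOrtholattice isOrtholattice public

  -- L-monotony makes _&_ respect _≈_ on the left.  Congruence on the right,
  -- automatic when _≈_ is _≡_, is deliberately not required.

  record IsSasakiOrthoposet (_&_ : Op₂ A) (_ᗮ : Op₁ A) (𝟏 𝟎 : A)
                            : Set (a ⊔ ℓ₁ ⊔ ℓ₂) where
    field
      isBoundedOrthoposet : IsBoundedOrthoposet _ᗮ 𝟏 𝟎
      L-monotony          : ∀ {x y z} → x ≤ y → (x & z) ≤ (y & z)
      R-reduction         : ∀ x y → (x & y) ≤ y
      orthomodularity     : ∀ {x y} → x ≤ y → x ≈ (x & y)
      galois              : ∀ {x y z} → (x & y) ≤ z → ((z ᗮ) & y) ≤ (x ᗮ)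

    open IsBoundedOrthoposet isBoundedOrthoposet public

record SasakiOrthoposet c ℓ₁ ℓ₂ : Set (suc (c ⊔ ℓ₁ ⊔ ℓ₂)) where
  infix  4 _≈_ _≤_
  infixr 7 _&_ _∧&_
  infix  8 _ᗮ
  field
    Carrier            : Set c
    _≈_                : Rel Carrier ℓ₁
    _≤_                : Rel Carrier ℓ₂
    _&_                : Op₂ Carrier
    _ᗮ                 : Op₁ Carrier
    𝟏                  : Carrier
    𝟎                  : Carrier
    isSasakiOrthoposet : IsSasakiOrthoposet _≈_ _≤_ _&_ _ᗮ 𝟏 𝟎

  open IsSasakiOrthoposet isSasakiOrthoposet public

  _∧&_ : Op₂ Carrier
  x ∧& y = (x ᗮ & y) ᗮ & y

{-# OPTIONS --safe #-}
-- The Sasaki hook y ⇝ x = (xᗮ & y)ᗮ is right adjoint to _& y, by Galois and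
-- the involution.  Since z & y ≈ z for z ≤ y, the element x ∧& y = (y ⇝ x) & y
-- is the meet of x and y.  If moreover x ≤ y, then y ⇝ x lies above both x and
-- yᗮ, so z ≤ x ∨ yᗮ gives z & y ≤ x, which is the orthomodular law.
module Submission where

open import Defs
open import Algebra.Core using (Op₂)
open import Data.Product using (Σ; _,_)
open import Relation.Binary.Lattice.Definitions using (Infimum; Supremum)

module SasakiOrthoposetProperties {c ℓ₁ ℓ₂} (S : SasakiOrthoposet c ℓ₁ ℓ₂) where
  open SasakiOrthoposet S

  infixr 6 _∨&_
  infixr 5 _⇝_

  _⇝_ : Op₂ Carrier
  y ⇝ x = (x ᗮ & y) ᗮ

  _∨&_ : Op₂ Carrier
  x ∨& y = (x ᗮ ∧& y ᗮ) ᗮ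

  x≤xᗮᗮ : ∀ {x} → x ≤ x ᗮ ᗮ
  x≤xᗮᗮ {x} = reflexive (Eq.sym (ᗮ-involutive x))

  xᗮᗮ≤x : ∀ {x} → x ᗮ ᗮ ≤ x
  xᗮᗮ≤x {x} = reflexive (ᗮ-involutive x)

  ᗮ-swapʳ : ∀ {x y} → x ≤ y ᗮ → y ≤ x ᗮ
  ᗮ-swapʳ x≤yᗮ = trans x≤xᗮᗮ (ᗮ-antitone x≤yᗮ)

  ᗮ-swapˡ : ∀ {x y} → x ᗮ ≤ y → y ᗮ ≤ x
  ᗮ-swapˡ xᗮ≤y = trans (ᗮ-antitone xᗮ≤y) xᗮᗮ≤x

  &⇒⇝ : ∀ {x y z} → z & y ≤ x → z ≤ y ⇝ x
  &⇒⇝ z&y≤x = ᗮ-swapʳ (galois z&y≤x)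

  -- Galois applied to the trivial `x ᗮ & y ≤ x ᗮ & y` gives the counit `(y ⇝ x) & y ≤ x ᗮ ᗮ`;
  -- L-monotony carries it over to `z`.
  ⇝⇒& : ∀ {x y z} → z ≤ y ⇝ x → z & y ≤ x
  ⇝⇒& z≤y⇝x = trans (L-monotony z≤y⇝x) (trans (galois refl) xᗮᗮ≤x)

  x≤y⇒x≤x&y : ∀ {x y} → x ≤ y → x ≤ x & y
  x≤y⇒x≤x&y x≤y = reflexive (orthomodularity x≤y)

  x≤y⇒x&y≤x : ∀ {x y} → x ≤ y → x & y ≤ x
  x≤y⇒x&y≤x x≤y = reflexive (Eq.sym (orthomodularity x≤y))

  x∧&y≤x : ∀ x y → x ∧& y ≤ x
  -- `x ∧& y` unfolds to `(y ⇝ x) & y`, so this is the counit.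
  x∧&y≤x x y = ⇝⇒& refl

  x∧&y≤y : ∀ x y → x ∧& y ≤ y
  x∧&y≤y x y = R-reduction (y ⇝ x) y

  ∧&-greatest : ∀ {x y z} → z ≤ x → z ≤ y → z ≤ x ∧& y
  ∧&-greatest z≤x z≤y =
    -- Replacing `z` by `z & y` leaves only `z ≤ y ⇝ x` to show, which is adjoint to `z & y ≤ x`.
    trans (x≤y⇒x≤x&y z≤y) (L-monotony (&⇒⇝ (trans (x≤y⇒x&y≤x z≤y) z≤x)))

  ∧&-infimum : Infimum _≤_ _∧&_
  ∧&-infimum x y = x∧&y≤x x y , x∧&y≤y x y , λ _ → ∧&-greatest

  x≤x∨&y : ∀ x y → x ≤ x ∨& y
  x≤x∨&y x y = ᗮ-swapʳ (x∧&y≤x (x ᗮ) (y ᗮ))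

  y≤x∨&y : ∀ x y → y ≤ x ∨& y
  y≤x∨&y x y = ᗮ-swapʳ (x∧&y≤y (x ᗮ) (y ᗮ))

  ∨&-least : ∀ {x y z} → x ≤ z → y ≤ z → x ∨& y ≤ z
  ∨&-least x≤z y≤z = ᗮ-swapˡ (∧&-greatest (ᗮ-antitone x≤z) (ᗮ-antitone y≤z))

  ∨&-supremum : Supremum _≤_ _∨&_
  ∨&-supremum x y = x≤x∨&y x y , y≤x∨&y x y , λ _ → ∨&-least

  -- The bound on `y ᗮ` is R-reduction for `x ᗮ & y`, complemented; only the bound on `x` uses
  -- `x ≤ y`.
  x≤y⇒x∨&yᗮ≤y⇝x : ∀ {x y} → x ≤ y → x ∨& y ᗮ ≤ y ⇝ x
  x≤y⇒x∨&yᗮ≤y⇝x {x} {y} x≤y =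
    ∨&-least (&⇒⇝ (x≤y⇒x&y≤x x≤y)) (ᗮ-antitone (R-reduction (x ᗮ) y))

  ∧&-∨&-orthomodular : ∀ {x y} → x ≤ y → x ≈ y ∧& (x ∨& y ᗮ)
  ∧&-∨&-orthomodular {x} {y} x≤y = antisym
    (∧&-greatest x≤y (x≤x∨&y x (y ᗮ)))
    -- The meet `m` lies below `y`, so `m ≤ m & y`; it also lies below `y ⇝ x`, so `m & y ≤ x`.
    (trans (x≤y⇒x≤x&y (x∧&y≤x y (x ∨& y ᗮ)))
           (⇝⇒& (trans (x∧&y≤y y (x ∨& y ᗮ)) (x≤y⇒x∨&yᗮ≤y⇝x x≤y))))

  isOrthomodularLattice : IsOrthomodularLattice _≈_ _≤_ _∨&_ _∧&_ _ᗮ 𝟏 𝟎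
  isOrthomodularLattice = record
    { isOrtholattice = record
      { isBoundedOrthoposet = isBoundedOrthoposet
      ; isLattice           = record
        { isPartialOrder = isPartialOrder
        ; supremum       = ∨&-supremum
        ; infimum        = ∧&-infimum
        }
      }
    ; orthomodular = ∧&-∨&-orthomodular
    }

proposition5 : ∀ {c ℓ₁ ℓ₂} (S : SasakiOrthoposet c ℓ₁ ℓ₂) →
    let open SasakiOrthoposet S in
    Σ (Op₂ Carrier) λ _∨_ → IsOrthomodularLattice _≈_ _≤_ _∨_ _∧&_ _ᗮ 𝟏 𝟎
proposition5 S = _∨&_ , isOrthomodularLattice
  where open SasakiOrthoposetProperties S
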